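{- For fixed $k\in\{1,\dots,n-1\}$, the number of boolean intervals $[\sigma_k,w]_{\mathrm{wk}}$ (with $w\in\mathfrak{S}_n$, $\sigma_k\le_{\mathrm{wk}}w$) in the weak order on $\mathfrak{S}_n$ is $F_{k+1}F_{n-k+1}$, where $F_i$ is the $i$th Fibonacci number.
   Context: $\mathfrak{S}_n$ is the symmetric group with Coxeter generators $\sigma_1,\dots,\sigma_{n-1}$, where $\sigma_i$ is the transposition swapping $i$ and $i+1$. A reduced decomposition of $w$ is a word of minimal length in these generators with product $w$. (Right) weak order: $v\le_{\mathrm{wk}}w$ if some reduced decomposition of $v$ is a prefix of a reduced decomposition of $w$. $[v,w]_{\mathrm{wk}}=\{u: v\le_{\mathrm{wk}}u\le_{\mathrm{wk}}w\}$ for $v\le_{\mathrm{wk}}w$. A poset is boolean if it is isomorphic to the poset of all subsets of a finite set, ordered by inclusion. Fibonacci numbers are indexed by $F_0=0$, $F_1=1$. -}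

module Defs where

open import Data.Fin.Base using (Fin; inject₁; suc)
open import Data.Fin.Permutation using (Permutation′; _⟨$⟩ʳ_; _≈_; id; _∘ₚ_; transpose)
open import Data.Fin.Subset using (Subset; _⊆_)
open import Data.List.Base using (List; []; _∷_; _++_; foldr; length)
open import Data.List.Properties using (++-assoc; ++-identityʳ; length-++)
open import Data.Nat.Base using (ℕ; zero; suc; _+_; _≤_)
open import Data.Nat.Properties
  using (+-monoˡ-≤; +-cancelˡ-≤; m≤m+n; +-identityʳ; module ≤-Reasoning)
open import Data.Product.Base using (Σ; ∃-syntax; _×_; _,_; proj₁)
open import Function.Bundles using (Inverse)
open import Level using (0ℓ)
open import Relation.Binary.Bundles using (Setoid; Poset)
open import Relation.Binary.Morphism.Structures using (IsOrderIsomorphism)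
open import Relation.Binary.PropositionalEquality
  using (_≡_; refl; sym; trans; cong; subst; setoid)

fib : ℕ → ℕ
fib zero          = 0
fib (suc zero)    = 1
fib (suc (suc n)) = fib (suc n) + fib n

-- The symmetric group on n = suc m letters is Permutation′ (suc m), always
-- taken up to the pointwise equality _≈_.  Letters and generators are counted
-- from 0, so the Coxeter generator σ_k (1 ≤ k ≤ n - 1) is σ i with k = suc (toℕ i).

module _ {m : ℕ} where

  σ : Fin m → Permutation′ (suc m)
  σ i = transpose (inject₁ i) (suc i)

  -- _∘ₚ_ is diagrammatic: π ∘ₚ ρ applies π first.  Hence
  -- evaluate (i₁ ∷ … ∷ iₗ ∷ []) is the functional composite σ i₁ ∘ … ∘ σ iₗ.
  evaluate : List (Fin m) → Permutation′ (suc m)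
  evaluate = foldr (λ i π → π ∘ₚ σ i) id

  IsReducedDecomposition : Permutation′ (suc m) → List (Fin m) → Set
  IsReducedDecomposition w a =
    evaluate a ≈ w × (∀ b → evaluate b ≈ w → length a ≤ length b)

  infix 4 _≤wk_

  _≤wk_ : Permutation′ (suc m) → Permutation′ (suc m) → Set
  v ≤wk w = ∃[ a ] ∃[ b ] IsReducedDecomposition v a × IsReducedDecomposition w (a ++ b)

  evaluate-++ : ∀ a b → evaluate (a ++ b) ≈ evaluate b ∘ₚ evaluate a
  evaluate-++ []      b x = refl
  evaluate-++ (i ∷ a) b x = cong (σ i ⟨$⟩ʳ_) (evaluate-++ a b x)

  reduced-resp-≈ : ∀ {v w a} → v ≈ w → IsReducedDecomposition v a → IsReducedDecomposition w a
  reduced-resp-≈ v≈w (a≈v , min) =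
    (λ x → trans (a≈v x) (v≈w x)) ,
    (λ b b≈w → min b (λ x → trans (b≈w x) (sym (v≈w x))))

  ≤wk-trans : ∀ {u v w} → u ≤wk v → v ≤wk w → u ≤wk w
  ≤wk-trans {u} {v} {w} (a , b , ra , (ab≈v , minab)) (c , d , (c≈v , _) , (cd≈w , mincd)) =
    a , b ++ d , ra ,
    subst (IsReducedDecomposition w) (++-assoc a b d) (abd≈w , minabd)
    where
    abd≈w : evaluate ((a ++ b) ++ d) ≈ w
    abd≈w x = trans (evaluate-++ (a ++ b) d x)
      (trans (ab≈v _) (trans (sym (c≈v _)) (trans (sym (evaluate-++ c d x)) (cd≈w x))))

    minabd : ∀ e → evaluate e ≈ w → length ((a ++ b) ++ d) ≤ length e
    minabd e e≈w = begin
      length ((a ++ b) ++ d)       ≡⟨ length-++ (a ++ b) ⟩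
      length (a ++ b) + length d   ≤⟨ +-monoˡ-≤ (length d) (minab c c≈v) ⟩
      length c + length d          ≡⟨ length-++ c ⟨
      length (c ++ d)              ≤⟨ mincd e e≈w ⟩
      length e                     ∎
      where open ≤-Reasoning

  ≤wk-antisym : ∀ {v w} → v ≤wk w → w ≤wk v → v ≈ w
  ≤wk-antisym {v} {w} (a , b , (a≈v , _) , (ab≈w , minab)) (c , d , (c≈w , _) , (_ , mincd)) x =
    trans (sym (a≈v x)) (trans (cong (λ e → evaluate e ⟨$⟩ʳ x) a≡ab) (ab≈w x))
    where
    ∣b∣≤0 : length b ≤ 0
    ∣b∣≤0 = +-cancelˡ-≤ (length a) (length b) 0 (begin
      length a + length b   ≡⟨ length-++ a ⟨
      length (a ++ b)       ≤⟨ minab c c≈w ⟩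
      length c              ≤⟨ m≤m+n (length c) (length d) ⟩
      length c + length d   ≡⟨ length-++ c ⟨
      length (c ++ d)       ≤⟨ mincd a a≈v ⟩
      length a              ≡⟨ +-identityʳ (length a) ⟨
      length a + 0          ∎)
      where open ≤-Reasoning

    empty : ∀ (e : List (Fin m)) → length e ≤ 0 → e ≡ []
    empty [] _ = refl

    a≡ab : a ≡ a ++ b
    a≡ab = sym (trans (cong (a ++_) (empty b ∣b∣≤0)) (++-identityʳ a))

  -- Reflexivity is read off from the lower bound: v ≤wk u already provides a
  -- reduced decomposition of u.
  Interval : Permutation′ (suc m) → Permutation′ (suc m) → Poset 0ℓ 0ℓ 0ℓ
  Interval v w = record
    { Carrier        = Σ (Permutation′ (suc m)) λ u → v ≤wk u × u ≤wk w
    ; _≈_            = λ p q → proj₁ p ≈ proj₁ q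
    ; _≤_            = λ p q → proj₁ p ≤wk proj₁ q
    ; isPartialOrder = record
      { isPreorder = record
        { isEquivalence = record
          { refl  = λ _ → refl
          ; sym   = λ p≈q x → sym (p≈q x)
          ; trans = λ p≈q q≈r x → trans (p≈q x) (q≈r x)
          }
        ; reflexive = λ { {u , (a , b , _ , rab) , _} {u′ , _} u≈u′ →
            a ++ b , [] , rab ,
            subst (IsReducedDecomposition u′) (sym (++-identityʳ (a ++ b)))
              (reduced-resp-≈ {u} {u′} {a ++ b} u≈u′ rab) }
        ; trans = λ {p} {q} {r} → ≤wk-trans {proj₁ p} {proj₁ q} {proj₁ r}
        }
      ; antisym = λ {p} {q} → ≤wk-antisym {proj₁ p} {proj₁ q}
      }
    }

IsBoolean : Poset 0ℓ 0ℓ 0ℓ → Set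
IsBoolean P = ∃[ r ] Σ (Carrier → Subset r) (IsOrderIsomorphism P._≈_ _≡_ P._≤_ _⊆_)
  where
  module P = Poset P
  open P using (Carrier)

-- The boolean intervals [v , w] with bottom v.  An interval is determined by
-- its top element, so two of them are equal exactly when their tops are.
BooleanIntervalsFrom : ∀ {m} → Permutation′ (suc m) → Setoid 0ℓ 0ℓ
BooleanIntervalsFrom {m} v = record
  { Carrier       = Σ (Permutation′ (suc m)) λ w → v ≤wk w × IsBoolean (Interval v w)
  ; _≈_           = λ p q → proj₁ p ≈ proj₁ q
  ; isEquivalence = record
    { refl  = λ _ → refl
    ; sym   = λ p≈q x → sym (p≈q x)
    ; trans = λ p≈q q≈r x → trans (p≈q x) (q≈r x)
    }
  }

HasCardinality : Setoid 0ℓ 0ℓ → ℕ → Set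
HasCardinality S N = Inverse (setoid (Fin N)) S

{-# OPTIONS --safe #-}
module Submission where

-- Write σ_k x for the elements above σ_k.  The interval [σ_k , w] is boolean
-- exactly when w = σ_k x with x a product of pairwise commuting distinct
-- generators other than σ_k:
-- * in a boolean interval every rank 2 subinterval p < p x < p x y contains a
--   fourth element, which forces σ_x and σ_y to commute, and commutations
--   bring any two letters of a reduced word next to each other;
-- * conversely a word with distinct letters is reduced, and every reduced word
--   of its product uses the same letters, so that [σ_k , σ_k x] is the lattice
--   of subsets of the letters of x.
-- Hence the intervals correspond to the independent sets of the path
-- 1 - 2 - … - (n - 1) avoiding k, that is, to pairs of independent sets of
-- paths on k - 1 and n - 1 - k vertices.

open import Defs
open import Data.Bool.Base using (Bool; true; false; if_then_else_)
import Data.Bool.Properties as Bool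
open import Data.Bool.Properties using (⇔→≡; ¬-not)
open import Data.Empty using (⊥)
open import Data.Fin.Base as Fin using (Fin; toℕ; inject₁)
open import Data.Fin.Permutation using (Permutation′; _⟨$⟩ʳ_; _≈_; lift₀-transpose)
import Data.Fin.Properties as Fin
import Data.Fin.Subset as Sub
import Data.Fin.Subset.Properties as Sub
open import Data.List.Base using (List; []; _∷_; _++_; length; filter; map; allFin; lookup)
import Data.List.Membership.DecPropositional as DecMembership
open import Data.List.Membership.Propositional using (_∈_; _∉_)
open import Data.List.Membership.Propositional.Properties
  using (∈-∃++; ∈-++⁺ˡ; ∈-map⁺; ∈-map⁻; ∈-filter⁺; ∈-filter⁻; ∈-allFin; ∈-lookup; ∈-AllPairs₂)
open import Data.List.Properties using (++-assoc; ++-identityʳ; length-++)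
open import Data.List.Relation.Binary.Permutation.Propositional
  using (_↭_; refl; prep; swap; trans; ↭-refl; ↭-sym; ↭-trans; ↭-prep; ↭⇒↭ₛ)
import Data.List.Relation.Binary.Permutation.Propositional.Properties as ↭
open ↭ using (∈-resp-↭; ↭-length; shift; drop-∷)
import Data.List.Relation.Binary.Permutation.Setoid.Properties as ↭ₛ
open import Data.List.Relation.Binary.Subset.Propositional using (_⊆_)
open import Data.List.Relation.Unary.All as All using (All; []; _∷_)
import Data.List.Relation.Unary.All.Properties as All
open import Data.List.Relation.Unary.AllPairs as AllPairs using (AllPairs; []; _∷_)
open import Data.List.Relation.Unary.Any as Any using (here; there)
open import Data.List.Relation.Unary.Any.Properties using (lookup-index)
open import Data.List.Relation.Unary.Unique.Propositional using (Unique)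
open import Data.List.Relation.Unary.Unique.Propositional.Properties
  using (map⁺; filter⁺; allFin⁺)
open import Data.Nat.Base using (ℕ; zero; suc; _+_; _∸_; _*_; _≤_; _<_; z≤n; s≤s; z<s)
import Data.Nat.Properties as ℕ
open import Data.Product.Base using (∃-syntax; _×_; _,_; proj₁; proj₂)
open import Data.Product.Function.NonDependent.Propositional using (_×-↔_)
open import Data.Sum.Base as Sum using (_⊎_; inj₁; inj₂)
open import Data.Sum.Function.Propositional using (_⊎-↔_)
import Data.Vec.Base as Vec
import Data.Vec.Properties as Vec
open import Function.Base using (_∘_)
open import Function.Bundles using (Inverse; _↔_; mk⇔)
import Function.Construct.Composition as Composition
open Composition using (_↔-∘_)
open import Function.Construct.Identity using (↔-id)
open import Level using (0ℓ)
open import Relation.Binary.Bundles using (Poset; Setoid)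
open import Relation.Binary.Definitions using (Symmetric; tri<; tri≈; tri>)
open import Relation.Binary.Morphism.Structures using (IsOrderIsomorphism)
open import Relation.Binary.PropositionalEquality as ≡
  using (_≡_; _≢_; refl; sym; cong; cong₂; subst; subst₂; setoid)
open import Relation.Nullary using (¬_; does; yes; no; contradiction)
open import Relation.Nullary.Decidable using (dec-true; does-⇔)

module _ {a} {A : Set a} where

  Unique∧⊆⇒↭ : ∀ {xs ys : List A} → Unique xs → xs ⊆ ys → ∃[ zs ] ys ↭ xs ++ zs
  Unique∧⊆⇒↭ {[]}     {ys} _ _ = ys , ↭-refl
  Unique∧⊆⇒↭ {x ∷ xs} (x∉ ∷ uxs) xs⊆ys
    with ps , qs , refl ← ∈-∃++ (xs⊆ys (here refl))
    with zs , eq ← Unique∧⊆⇒↭ {ys = ps ++ qs} uxs (λ {y} y∈xs → Any.tail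
           (λ y≡x → All.lookup x∉ y∈xs (sym y≡x))
           (∈-resp-↭ (shift x ps qs) (xs⊆ys (there y∈xs))))
    = zs , ↭-trans (shift x ps qs) (↭-prep x eq)

  Unique∧⊆∧≤⇒↭ : ∀ {xs ys : List A} → Unique xs → xs ⊆ ys → length ys ≤ length xs → ys ↭ xs
  Unique∧⊆∧≤⇒↭ {xs} uxs xs⊆ys len with Unique∧⊆⇒↭ uxs xs⊆ys
  ... | []     , eq = subst (_ ↭_) (++-identityʳ xs) eq
  ... | z ∷ zs , eq = contradiction len (ℕ.<⇒≱ (subst (length xs <_)
    (≡.trans (sym (length-++ xs)) (sym (↭-length eq))) (ℕ.m<m+n (length xs) z<s)))

  Unique∧⊆⇒≤ : ∀ {xs ys : List A} → Unique xs → xs ⊆ ys → length xs ≤ length ys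
  Unique∧⊆⇒≤ {xs} uxs xs⊆ys with zs , eq ← Unique∧⊆⇒↭ uxs xs⊆ys =
    subst (length xs ≤_) (≡.trans (sym (length-++ xs)) (sym (↭-length eq))) (ℕ.m≤m+n _ _)

  AllPairs-resp-↭ : ∀ {r} {R : A → A → Set r} → Symmetric R →
                    ∀ {xs ys} → xs ↭ ys → AllPairs R xs → AllPairs R ys
  AllPairs-resp-↭ {R = R} sy p =
    ↭ₛ.AllPairs-resp-↭ (≡.setoid A) sy ((λ {refl r → r}) , λ {refl r → r}) (↭⇒↭ₛ p)

  AllPairs-fromUnique : ∀ {r} {R : A → A → Set r} {xs} → Unique xs →
                        (∀ {x y} → x ∈ xs → y ∈ xs → x ≢ y → R x y) → AllPairs R xs
  AllPairs-fromUnique []        f = []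
  AllPairs-fromUnique (x∉ ∷ u) f =
    All.tabulate (λ y∈ → f (here refl) (there y∈) (All.lookup x∉ y∈)) ∷
    AllPairs-fromUnique u (λ p q → f (there p) (there q))

  AllPairs-fromSwaps : ∀ {r g} {R : A → A → Set r} (G : List A → Set g) →
    (∀ p x y q → G (p ++ x ∷ y ∷ q) → R x y × G (p ++ y ∷ x ∷ q)) →
    ∀ b → G b → AllPairs R b
  AllPairs-fromSwaps {R = R} G step = go []
    where
    move : ∀ p x q → G (p ++ x ∷ q) → All (R x) q
    move p x []      g = []
    move p x (y ∷ q) g with r , g′ ← step p x y q g =
      r ∷ move (p ++ y ∷ []) x q (subst G (sym (++-assoc p (y ∷ []) (x ∷ q))) g′)
    go : ∀ p b → G (p ++ b) → AllPairs R b
    go p []      g = []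
    go p (x ∷ b) g = move p x b g ∷
      go (p ++ x ∷ []) b (subst G (sym (++-assoc p (x ∷ []) b)) g)

  AllPairs-++⁻ˡ : ∀ {r} {R : A → A → Set r} xs {ys} → AllPairs R (xs ++ ys) → AllPairs R xs
  AllPairs-++⁻ˡ []       _         = []
  AllPairs-++⁻ˡ (x ∷ xs) (px ∷ ap) = All.++⁻ˡ xs px ∷ AllPairs-++⁻ˡ xs ap

  AllPairs⇒related : ∀ {r} {R : A → A → Set r} → Symmetric R → ∀ {xs x y} →
                     AllPairs R xs → x ∈ xs → y ∈ xs → x ≢ y → R x y
  AllPairs⇒related sy ap x∈ y∈ x≢y with ∈-AllPairs₂ ap x∈ y∈
  ... | inj₁ x≡y        = contradiction x≡y x≢y
  ... | inj₂ (inj₁ xRy) = xRy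
  ... | inj₂ (inj₂ yRx) = sy yRx

  Unique⇒lookup-injective : ∀ {xs : List A} → Unique xs → ∀ {j k} → lookup xs j ≡ lookup xs k → j ≡ k
  Unique⇒lookup-injective (_ ∷ _)  {Fin.zero}  {Fin.zero}  _  = refl
  Unique⇒lookup-injective (x∉ ∷ _) {Fin.zero}  {Fin.suc k} eq = contradiction eq (All.lookup x∉ (∈-lookup k))
  Unique⇒lookup-injective (x∉ ∷ _) {Fin.suc j} {Fin.zero}  eq = contradiction (sym eq) (All.lookup x∉ (∈-lookup j))
  Unique⇒lookup-injective (_ ∷ u)  {Fin.suc j} {Fin.suc k} eq = cong Fin.suc (Unique⇒lookup-injective u eq)

-- Simple transpositions on ℕ

s : ℕ → ℕ → ℕ
s zero    zero          = 1
s zero    (suc zero)    = 0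
s zero    (suc (suc x)) = suc (suc x)
s (suc k) zero          = zero
s (suc k) (suc x)       = suc (s k x)

s-involutive : ∀ k x → s k (s k x) ≡ x
s-involutive zero    zero          = refl
s-involutive zero    (suc zero)    = refl
s-involutive zero    (suc (suc x)) = refl
s-involutive (suc k) zero          = refl
s-involutive (suc k) (suc x)       = cong suc (s-involutive k x)

s-ascends : ∀ k → s k k ≡ suc k
s-ascends zero    = refl
s-ascends (suc k) = cong suc (s-ascends k)

s-≤ : ∀ {l j v} → l ≢ j → v ≤ j → s l v ≤ j
s-≤ {zero}  {zero}  {zero}        l≢j _       = contradiction refl l≢j
s-≤ {zero}  {suc j} {zero}        l≢j _       = s≤s z≤n
s-≤ {zero}  {j}     {suc zero}    l≢j _       = z≤n
s-≤ {zero}  {j}     {suc (suc v)} l≢j v≤j     = v≤j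
s-≤ {suc l} {j}     {zero}        l≢j _       = z≤n
s-≤ {suc l} {suc j} {suc v}       l≢j (s≤s p) = s≤s (s-≤ (l≢j ∘ cong suc) p)

s-> : ∀ {l j v} → l ≢ j → j < v → j < s l v
s-> {l} {j} {v} l≢j j<v = ℕ.≰⇒> λ p →
  ℕ.<⇒≱ j<v (subst (_≤ j) (s-involutive l v) (s-≤ l≢j p))

Apart : ℕ → ℕ → Set
Apart k l = suc k < l ⊎ suc l < k

Apart-sym : Symmetric Apart
Apart-sym = Sum.swap

Apart⇒≢ : ∀ {k l} → Apart k l → k ≢ l
Apart⇒≢ (inj₁ p) refl = ℕ.1+n≰n (ℕ.<⇒≤ p)
Apart⇒≢ (inj₂ p) refl = ℕ.1+n≰n (ℕ.<⇒≤ p)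

s-comm-< : ∀ {k l} x → suc k < l → s k (s l x) ≡ s l (s k x)
s-comm-< {zero}  {suc zero}    x             (s≤s ())
s-comm-< {zero}  {suc (suc l)} zero          _       = refl
s-comm-< {zero}  {suc (suc l)} (suc zero)    _       = refl
s-comm-< {zero}  {suc (suc l)} (suc (suc x)) _       = refl
s-comm-< {suc k} {suc l}       zero          _       = refl
s-comm-< {suc k} {suc l}       (suc x)       (s≤s p) = cong suc (s-comm-< x p)

s-comm : ∀ {k l} x → Apart k l → s k (s l x) ≡ s l (s k x)
s-comm x (inj₁ p) = s-comm-< x p
s-comm x (inj₂ p) = sym (s-comm-< x p)

s-suc-noncomm : ∀ k → s k (s (suc k) k) ≢ s (suc k) (s k k)
s-suc-noncomm (suc k) eq = s-suc-noncomm k (ℕ.suc-injective eq)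
s-suc-noncomm zero    ()

comm⇒Apart : ∀ {k l} → k ≢ l → s k (s l k) ≡ s l (s k k) → s k (s l l) ≡ s l (s k l) → Apart k l
comm⇒Apart {k} {l} k≢l at-k at-l with ℕ.<-cmp k l
... | tri≈ _ k≡l _ = contradiction k≡l k≢l
... | tri< k<l _ _ with ℕ.m≤n⇒m<n∨m≡n k<l
...   | inj₁ p    = inj₁ p
...   | inj₂ refl = contradiction at-k (s-suc-noncomm k)
comm⇒Apart {k} {l} k≢l at-k at-l | tri> _ _ l<k with ℕ.m≤n⇒m<n∨m≡n l<k
...   | inj₁ p    = inj₂ p
...   | inj₂ refl = contradiction (sym at-l) (s-suc-noncomm l)

toℕ-σ : ∀ {m} (i : Fin m) x → toℕ (σ i ⟨$⟩ʳ x) ≡ s (toℕ i) (toℕ x)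
toℕ-σ Fin.zero    Fin.zero              = refl
toℕ-σ Fin.zero    (Fin.suc Fin.zero)    = refl
toℕ-σ Fin.zero    (Fin.suc (Fin.suc x)) = refl
toℕ-σ (Fin.suc i) Fin.zero    = refl
toℕ-σ (Fin.suc i) (Fin.suc x) = ≡.trans
  (cong toℕ (lift₀-transpose (inject₁ i) (Fin.suc i) (Fin.suc x)))
  (cong suc (toℕ-σ i x))

module _ {m : ℕ} where

  open DecMembership (Fin._≟_ {m}) using (_∈?_)

  private
    Word = List (Fin m)
    variable
      a b c e q : Word
      x y z z′ i j : Fin m
      u w : Permutation′ (suc m)

  σ-involutive : ∀ (l : Fin m) t → σ l ⟨$⟩ʳ (σ l ⟨$⟩ʳ t) ≡ t
  σ-involutive l t = Fin.toℕ-injective (≡.trans (toℕ-σ l _)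
    (≡.trans (cong (s (toℕ l)) (toℕ-σ l t)) (s-involutive (toℕ l) (toℕ t))))

  σ-≤ : ∀ {l j : Fin m} {t} → l ≢ j → toℕ t ≤ toℕ j → toℕ (σ l ⟨$⟩ʳ t) ≤ toℕ j
  σ-≤ {l} {j} {t} l≢j t≤j = subst (_≤ toℕ j) (sym (toℕ-σ l t)) (s-≤ (l≢j ∘ Fin.toℕ-injective) t≤j)

  σ-> : ∀ {l j : Fin m} {t} → l ≢ j → toℕ j < toℕ t → toℕ j < toℕ (σ l ⟨$⟩ʳ t)
  σ-> {l} {j} {t} l≢j j<t = subst (toℕ j <_) (sym (toℕ-σ l t)) (s-> (l≢j ∘ Fin.toℕ-injective) j<t)

  _◁_ : Fin m → Fin m → Set
  x ◁ y = Apart (toℕ x) (toℕ y)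

  σ-comm : ∀ {x y : Fin m} → x ◁ y → ∀ t → σ x ⟨$⟩ʳ (σ y ⟨$⟩ʳ t) ≡ σ y ⟨$⟩ʳ (σ x ⟨$⟩ʳ t)
  σ-comm {x} {y} ap t = Fin.toℕ-injective (≡.trans (s² x y) (≡.trans (s-comm (toℕ t) ap) (sym (s² y x))))
    where
    s² : ∀ x y → toℕ (σ x ⟨$⟩ʳ (σ y ⟨$⟩ʳ t)) ≡ s (toℕ x) (s (toℕ y) (toℕ t))
    s² x y = ≡.trans (toℕ-σ x _) (cong (s (toℕ x)) (toℕ-σ y t))

  -- The parabolic subgroup generated by all letters except j preserves the
  -- set of points ≤ j, so a word that moves some point across j contains j.

  evaluate-≤ : ∀ e {t} → j ∉ e → toℕ t ≤ toℕ j → toℕ (evaluate e ⟨$⟩ʳ t) ≤ toℕ j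
  evaluate-≤ []      j∉ t≤j = t≤j
  evaluate-≤ (l ∷ e) j∉ t≤j = σ-≤ (λ { refl → j∉ (here refl) }) (evaluate-≤ e (j∉ ∘ there) t≤j)

  evaluate-≤-onto : ∀ e {t} → j ∉ e → toℕ t ≤ toℕ j →
                    ∃[ v ] toℕ v ≤ toℕ j × evaluate e ⟨$⟩ʳ v ≡ t
  evaluate-≤-onto []      {t} j∉ t≤j = t , t≤j , refl
  evaluate-≤-onto (l ∷ e) {t} j∉ t≤j
    with v , v≤j , eq ← evaluate-≤-onto e (j∉ ∘ there) (σ-≤ (λ { refl → j∉ (here refl) }) t≤j)
    = v , v≤j , ≡.trans (cong (σ l ⟨$⟩ʳ_) eq) (σ-involutive l t)

  Unique⇒crosses : Unique a → j ∈ a → ∃[ v ] toℕ v ≤ toℕ j × toℕ j < toℕ (evaluate a ⟨$⟩ʳ v)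
  Unique⇒crosses {j ∷ a} (j∉ ∷ ua) (here refl)
    with v , v≤j , eq ← evaluate-≤-onto a {inject₁ j} (λ j∈ → All.lookup j∉ j∈ refl)
                          (ℕ.≤-reflexive (Fin.toℕ-inject₁ j))
    = v , v≤j , ℕ.≤-reflexive (sym (≡.trans (cong (toℕ ∘ (σ j ⟨$⟩ʳ_)) eq)
        (≡.trans (toℕ-σ j _) (≡.trans (cong (s (toℕ j)) (Fin.toℕ-inject₁ j)) (s-ascends (toℕ j))))))
  Unique⇒crosses (l∉ ∷ ua) (there j∈)
    with v , v≤j , j< ← Unique⇒crosses ua j∈ = v , v≤j , σ-> (All.lookup l∉ j∈) j<

  Unique⇒letters-⊆ : Unique a → evaluate a ≈ evaluate e → a ⊆ e
  Unique⇒letters-⊆ {a} {e} ua eq {j} j∈a with j ∈? e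
  ... | yes j∈e = j∈e
  ... | no  j∉e with v , v≤j , j< ← Unique⇒crosses ua j∈a =
    contradiction (evaluate-≤ e j∉e v≤j) (ℕ.<⇒≱ (subst (λ t → toℕ j < toℕ t) (eq v) j<))

  Unique⇒reduced : Unique a → IsReducedDecomposition (evaluate a) a
  Unique⇒reduced ua = (λ _ → refl) ,
    λ e e≈a → Unique∧⊆⇒≤ ua (Unique⇒letters-⊆ {e = e} ua (λ t → sym (e≈a t)))

  Unique∧reduced⇒↭ : Unique a → IsReducedDecomposition w e → evaluate a ≈ w → e ↭ a
  Unique∧reduced⇒↭ {a} {w} {e} ua (e≈w , min) a≈w = Unique∧⊆∧≤⇒↭ ua
    (Unique⇒letters-⊆ {e = e} ua (λ t → ≡.trans (a≈w t) (sym (e≈w t)))) (min a a≈w)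

  evaluate-resp-↭ : AllPairs _◁_ b → b ↭ c → evaluate b ≈ evaluate c
  evaluate-resp-↭ _ refl t = refl
  evaluate-resp-↭ (_ ∷ ab) (prep x p) t = cong (σ x ⟨$⟩ʳ_) (evaluate-resp-↭ ab p t)
  evaluate-resp-↭ {_ ∷ _ ∷ b} ((x◁y ∷ _) ∷ _ ∷ ab) (swap x y p) t =
    ≡.trans (σ-comm x◁y (evaluate b ⟨$⟩ʳ t))
    (cong (λ t → σ y ⟨$⟩ʳ (σ x ⟨$⟩ʳ t)) (evaluate-resp-↭ ab p t))
  evaluate-resp-↭ ab (trans p q) t = ≡.trans (evaluate-resp-↭ ab p t)
    (evaluate-resp-↭ (AllPairs-resp-↭ Apart-sym p ab) q t)

  ◁⇒≢ : x ◁ y → x ≢ y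
  ◁⇒≢ x◁y refl = Apart⇒≢ x◁y refl

  rank2-relation : x ≢ y → z ≢ x → evaluate (x ∷ y ∷ []) ≈ evaluate (z ∷ z′ ∷ []) → x ◁ y
  rank2-relation {x} {y} {z} {z′} x≢y z≢x eq
    with Unique⇒letters-⊆ {e = z ∷ z′ ∷ []} ((x≢y ∷ []) ∷ [] ∷ []) eq (here refl)
  ... | here x≡z = contradiction (sym x≡z) z≢x
  ... | there (here refl)
    with Unique⇒letters-⊆ {e = z ∷ x ∷ []} ((x≢y ∷ []) ∷ [] ∷ []) eq (there (here refl))
  ... | there (here y≡x) = contradiction (sym y≡x) x≢y
  ... | here refl = comm⇒Apart (x≢y ∘ Fin.toℕ-injective) (at x) (at y)
    where
    s² : ∀ x y t → toℕ (evaluate (x ∷ y ∷ []) ⟨$⟩ʳ inject₁ t) ≡ s (toℕ x) (s (toℕ y) (toℕ t))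
    s² x y t = ≡.trans (toℕ-σ x _) (cong (s (toℕ x))
      (≡.trans (toℕ-σ y _) (cong (s (toℕ y)) (Fin.toℕ-inject₁ t))))
    at : ∀ t → s (toℕ x) (s (toℕ y) (toℕ t)) ≡ s (toℕ y) (s (toℕ x) (toℕ t))
    at t = ≡.trans (sym (s² x y t)) (≡.trans (cong toℕ (eq (inject₁ t))) (s² y x t))

  evaluate-cancelˡ : ∀ a → evaluate (a ++ b) ≈ evaluate (a ++ c) → evaluate b ≈ evaluate c
  evaluate-cancelˡ []      eq = eq
  evaluate-cancelˡ {b} {c} (i ∷ a) eq = evaluate-cancelˡ a λ t →
    ≡.trans (sym (σ-involutive i (evaluate (a ++ b) ⟨$⟩ʳ t)))
      (≡.trans (cong (σ i ⟨$⟩ʳ_) (eq t)) (σ-involutive i (evaluate (a ++ c) ⟨$⟩ʳ t)))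

  evaluate-congˡ : ∀ a → evaluate b ≈ evaluate c → evaluate (a ++ b) ≈ evaluate (a ++ c)
  evaluate-congˡ []      eq = eq
  evaluate-congˡ (i ∷ a) eq t = cong (σ i ⟨$⟩ʳ_) (evaluate-congˡ a eq t)

  evaluate-congʳ : (a b c : Word) → evaluate a ≈ evaluate b → evaluate (a ++ c) ≈ evaluate (b ++ c)
  evaluate-congʳ a b c eq t = ≡.trans (evaluate-++ a c t)
    (≡.trans (eq (evaluate c ⟨$⟩ʳ t)) (sym (evaluate-++ b c t)))

  reduced-≤ : IsReducedDecomposition w a → evaluate b ≈ w → length b ≤ length a →
              IsReducedDecomposition w b
  reduced-≤ (_ , min) b≈w b≤a = b≈w , λ e e≈w → ℕ.≤-trans b≤a (min e e≈w)

  reduced-length : IsReducedDecomposition w a → IsReducedDecomposition w b → length a ≡ length b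
  reduced-length {w} {a} {b} (a≈w , mina) (b≈w , minb) = ℕ.≤-antisym (mina b b≈w) (minb a a≈w)

  reduced-prefix : ∀ a b → IsReducedDecomposition w (a ++ b) →
                   IsReducedDecomposition (evaluate a) a
  reduced-prefix a b (ab≈w , min) = (λ _ → refl) , λ e e≈a →
    ℕ.+-cancelʳ-≤ (length b) (length a) (length e)
      (subst₂ _≤_ (length-++ a) (length-++ e)
        (min (e ++ b) (λ t → ≡.trans (evaluate-congʳ e a b e≈a t) (ab≈w t))))

  reduced⇒≤wk : ∀ a b → IsReducedDecomposition w (a ++ b) → evaluate a ≤wk w
  reduced⇒≤wk {w} a b r = a , b , reduced-prefix {w} a b r , r

  ≤wk-extend : u ≤wk w → IsReducedDecomposition u a → ∃[ d ] IsReducedDecomposition w (a ++ d)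
  ≤wk-extend {u} {w} {a} (a′ , d , (a′≈u , mina′) , r@(a′d≈w , _)) (a≈u , mina) =
    d , reduced-≤ {w} {a′ ++ d} {a ++ d} r
      (λ t → ≡.trans (evaluate-congʳ a a′ d (λ t → ≡.trans (a≈u t) (sym (a′≈u t))) t) (a′d≈w t))
      (subst₂ _≤_ (sym (length-++ a)) (sym (length-++ a′)) (ℕ.+-monoˡ-≤ (length d) (mina a′ a′≈u)))

  ≤wk⇒length-≤ : u ≤wk w → IsReducedDecomposition u a → IsReducedDecomposition w b →
                 length a ≤ length b
  ≤wk⇒length-≤ {u} {w} {a} {b} u≤w ra (b≈w , _) with d , (_ , min) ← ≤wk-extend {u} {w} {a} u≤w ra =
    ℕ.≤-trans (subst (length a ≤_) (sym (length-++ a)) (ℕ.m≤m+n _ _)) (min b b≈w)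

  σ≤wk⇒head : σ i ≤wk w → ∃[ c ] IsReducedDecomposition w (i ∷ c)
  σ≤wk⇒head {i} {w} σ≤w = ≤wk-extend {σ i} {w} {i ∷ []} σ≤w
    (Unique⇒reduced {i ∷ []} ([] ∷ []))

  reduced-square-free : ∀ p → ¬ IsReducedDecomposition w (p ++ x ∷ x ∷ q)
  reduced-square-free {w} {x} {q} p (e , min) = ℕ.<⇒≱ shorter
    (min (p ++ q) (λ t → ≡.trans (evaluate-congˡ p (λ t → sym (σ-involutive x (evaluate q ⟨$⟩ʳ t))) t) (e t)))
    where
    shorter : length (p ++ q) < length (p ++ x ∷ x ∷ q)
    shorter = subst₂ _<_ (sym (length-++ p)) (sym (length-++ p))
      (ℕ.+-monoʳ-< (length p) (s≤s (ℕ.n≤1+n _)))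

-- In a boolean poset a chain lo < x < hi has a companion of x, namely the
-- complement of x relative to the interval from lo to hi.

module _ (P : Poset 0ℓ 0ℓ 0ℓ) where
  open Poset P using (Carrier) renaming (_≤_ to _⊑_)

  boolean⇒companion : IsBoolean P → ∀ {lo x hi} → lo ⊑ x → x ⊑ hi → ¬ x ⊑ lo → ¬ hi ⊑ x →
                      ∃[ u ] lo ⊑ u × u ⊑ hi × ¬ u ⊑ x × ¬ x ⊑ u
  boolean⇒companion (r , φ , iso) {lo} {x} {hi} lo⊑x x⊑hi x⋢lo hi⋢x =
    u , cancel (λ {j} j∈ → subst (j Sub.∈_) (sym φu≡S) (Sub.p⊆p∪q _ j∈))
      , cancel (λ {j} j∈ → S⊆φhi (subst (j Sub.∈_) φu≡S j∈))
      , (λ u⊑x → hi⋢x (cancel (φhi⊆φx (mono u⊑x))))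
      , (λ x⊑u → x⋢lo (cancel (φx⊆φlo (mono x⊑u))))
    where
    open IsOrderIsomorphism iso
    S : Sub.Subset r
    S = φ lo Sub.∪ (φ hi Sub.∩ Sub.∁ (φ x))
    u : Carrier
    u = proj₁ (surjective S)
    φu≡S : φ u ≡ S
    φu≡S = proj₂ (surjective S) (Poset.Eq.refl P)
    S⊆φhi : S Sub.⊆ φ hi
    S⊆φhi j∈ with Sub.x∈p∪q⁻ (φ lo) _ j∈
    ... | inj₁ j∈lo = mono x⊑hi (mono lo⊑x j∈lo)
    ... | inj₂ j∈   = proj₁ (Sub.x∈p∩q⁻ (φ hi) _ j∈)
    φhi⊆φx : φ u Sub.⊆ φ x → φ hi Sub.⊆ φ x
    φhi⊆φx φu⊆φx {j} j∈hi with j Sub.∈? φ x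
    ... | yes j∈x = j∈x
    ... | no  j∉x = φu⊆φx (subst (j Sub.∈_) (sym φu≡S)
      (Sub.q⊆p∪q (φ lo) _ (Sub.x∈p∩q⁺ (j∈hi , Sub.x∉p⇒x∈∁p j∉x))))
    φx⊆φlo : φ x Sub.⊆ φ u → φ x Sub.⊆ φ lo
    φx⊆φlo φx⊆φu {j} j∈x with Sub.x∈p∪q⁻ (φ lo) _ (subst (j Sub.∈_) φu≡S (φx⊆φu j∈x))
    ... | inj₁ j∈lo = j∈lo
    ... | inj₂ j∈   = contradiction j∈x (Sub.x∈∁p⇒x∉p (proj₂ (Sub.x∈p∩q⁻ (φ hi) _ j∈)))

module _ {m : ℕ} {i : Fin m} {w : Permutation′ (suc m)} where

  private
    I : Poset 0ℓ 0ℓ 0ℓ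
    I = Interval (σ i) w
    module I = Poset I

    element : ∀ a b → IsReducedDecomposition w ((i ∷ a) ++ b) → I.Carrier
    element a b r = evaluate (i ∷ a) ,
      (i ∷ [] , a , reduced-prefix {w = w} (i ∷ []) (a ++ b) r , reduced-prefix {w = w} (i ∷ a) b r) ,
      reduced⇒≤wk {w = w} (i ∷ a) b r

  boolean⇒consecutive-◁ : IsBoolean I → ∀ p x y q →
    IsReducedDecomposition w (i ∷ p ++ x ∷ y ∷ q) → x ◁ y
  boolean⇒consecutive-◁ bool p x y q r = rank2 (boolean⇒companion I bool {lo} {mi} {hi} lo≤mi mi≤hi mi≰lo hi≰mi)
    where
    rmi : IsReducedDecomposition w ((i ∷ p ++ x ∷ []) ++ y ∷ q)
    rmi = subst (IsReducedDecomposition w) (sym (++-assoc (i ∷ p) (x ∷ []) (y ∷ q))) r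
    rhi : IsReducedDecomposition w ((i ∷ p ++ x ∷ y ∷ []) ++ q)
    rhi = subst (IsReducedDecomposition w) (sym (++-assoc (i ∷ p) (x ∷ y ∷ []) q)) r
    lo mi hi : I.Carrier
    lo = element p (x ∷ y ∷ q) r
    mi = element (p ++ x ∷ []) (y ∷ q) rmi
    hi = element (p ++ x ∷ y ∷ []) q rhi
    rlo : IsReducedDecomposition (proj₁ lo) (i ∷ p)
    rlo = reduced-prefix {w = w} (i ∷ p) (x ∷ y ∷ q) r
    rmi′ : IsReducedDecomposition (proj₁ mi) (i ∷ p ++ x ∷ [])
    rmi′ = reduced-prefix {w = w} (i ∷ p ++ x ∷ []) (y ∷ q) rmi
    rhi′ : IsReducedDecomposition (proj₁ hi) (i ∷ p ++ x ∷ y ∷ [])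
    rhi′ = reduced-prefix {w = w} (i ∷ p ++ x ∷ y ∷ []) q rhi
    lo≤mi : lo I.≤ mi
    lo≤mi = reduced⇒≤wk {w = proj₁ mi} (i ∷ p) (x ∷ []) rmi′
    mi≤hi : mi I.≤ hi
    mi≤hi = reduced⇒≤wk {w = proj₁ hi} (i ∷ p ++ x ∷ []) (y ∷ [])
      (subst (IsReducedDecomposition (proj₁ hi)) (sym (++-assoc (i ∷ p) (x ∷ []) (y ∷ []))) rhi′)
    mi≰lo : ¬ mi I.≤ lo
    mi≰lo le = ℕ.m+1+n≰m (length p) (subst (_≤ length p) (length-++ p {x ∷ []})
      (ℕ.≤-pred (≤wk⇒length-≤ {u = proj₁ mi} {w = proj₁ lo} {i ∷ p ++ x ∷ []} {i ∷ p} le rmi′ rlo)))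
    hi≰mi : ¬ hi I.≤ mi
    hi≰mi le = ℕ.1+n≰n (ℕ.+-cancelˡ-≤ (length p) 2 1
      (subst₂ _≤_ (length-++ p {x ∷ y ∷ []}) (length-++ p {x ∷ []})
        (ℕ.≤-pred (≤wk⇒length-≤ {u = proj₁ hi} {w = proj₁ mi} {i ∷ p ++ x ∷ y ∷ []} {i ∷ p ++ x ∷ []} le rhi′ rmi′))))

    x≢y : x ≢ y
    x≢y refl = reduced-square-free {w = w} {q = q} (i ∷ p) r

    rank2 : ∃[ u ] lo I.≤ u × u I.≤ hi × ¬ u I.≤ mi × ¬ mi I.≤ u → x ◁ y
    rank2 (u , lo≤u , u≤hi , u≰mi , mi≰u)
      with c , ru ← ≤wk-extend {u = proj₁ lo} {w = proj₁ u} {a = i ∷ p} lo≤u rlo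
      with d , rcd@(cd≈hi , _) ← ≤wk-extend {u = proj₁ u} {w = proj₁ hi} {a = i ∷ p ++ c} u≤hi ru
      = split c d ru cd≈hi (ℕ.+-cancelˡ-≡ (suc (length p)) _ _ (≡.trans (sym (length-pcd c d))
          (≡.trans (reduced-length {w = proj₁ hi} {a = (i ∷ p ++ c) ++ d} {b = i ∷ p ++ x ∷ y ∷ []} rcd rhi′)
            (cong suc (length-++ p)))))
      where
      length-pcd : ∀ c d → length ((i ∷ p ++ c) ++ d) ≡ suc (length p) + (length c + length d)
      length-pcd c d = ≡.trans (cong (suc ∘ length) (++-assoc p c d))
        (cong suc (≡.trans (length-++ p) (cong (length p +_) (length-++ c))))
      split : ∀ c d → IsReducedDecomposition (proj₁ u) ((i ∷ p) ++ c) →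
              evaluate ((i ∷ p ++ c) ++ d) ≈ proj₁ hi → length c + length d ≡ 2 → x ◁ y
      split [] d (pc≈u , _) _ _ = contradiction (I.trans {u} {lo} {mi} (I.reflexive {u} {lo}
        (λ t → ≡.trans (sym (pc≈u t)) (cong (λ e → evaluate (i ∷ e) ⟨$⟩ʳ t) (++-identityʳ p)))) lo≤mi) u≰mi
      split (z ∷ z′ ∷ []) [] (pc≈u , _) pcd≈hi _ = contradiction (I.trans {mi} {hi} {u} mi≤hi
        (I.reflexive {hi} {u} (λ t → ≡.trans (sym (pcd≈hi t)) (≡.trans
          (cong (λ e → evaluate (i ∷ e) ⟨$⟩ʳ t) (++-identityʳ (p ++ z ∷ z′ ∷ []))) (pc≈u t))))) mi≰u
      split (z ∷ []) (z′ ∷ []) (pc≈u , _) pcd≈hi _ = rank2-relation {z′ = z′} x≢y z≢x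
        (λ t → sym (evaluate-cancelˡ {b = z ∷ z′ ∷ []} {c = x ∷ y ∷ []} (i ∷ p)
          (λ t → ≡.trans (cong (λ e → evaluate (i ∷ e) ⟨$⟩ʳ t) (sym (++-assoc p (z ∷ []) (z′ ∷ [])))) (pcd≈hi t)) t))
        where
        z≢x : z ≢ x
        z≢x refl = u≰mi (I.reflexive {u} {mi} (λ t → sym (pc≈u t)))

  boolean⇒commuting : ∀ {b} → IsBoolean I → IsReducedDecomposition w (i ∷ b) → AllPairs _◁_ b × i ∉ b
  boolean⇒commuting {b} bool r = ab , i∉b
    where
    step : ∀ p x y q → IsReducedDecomposition w (i ∷ p ++ x ∷ y ∷ q) →
           x ◁ y × IsReducedDecomposition w (i ∷ p ++ y ∷ x ∷ q)
    step p x y q r@(≈w , _) = x◁y , reduced-≤ {w = w} {a = i ∷ p ++ x ∷ y ∷ q} {b = i ∷ p ++ y ∷ x ∷ q} r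
      (λ t → ≡.trans (evaluate-congˡ {b = y ∷ x ∷ q} {c = x ∷ y ∷ q} (i ∷ p)
        (λ t → sym (σ-comm x◁y (evaluate q ⟨$⟩ʳ t))) t) (≈w t))
      (ℕ.≤-reflexive (cong suc (≡.trans (length-++ p) (sym (length-++ p)))))
      where
      x◁y : x ◁ y
      x◁y = boolean⇒consecutive-◁ bool p x y q r
    ab : AllPairs _◁_ b
    ab = AllPairs-fromSwaps (λ b → IsReducedDecomposition w (i ∷ b)) step b r
    i∉b : i ∉ b
    i∉b i∈b with p , q , refl ← ∈-∃++ i∈b = reduced-square-free {w = w} {x = i} {q = p ++ q} []
      (reduced-≤ {w = w} {a = i ∷ p ++ i ∷ q} {b = i ∷ i ∷ p ++ q} r
        (λ t → ≡.trans (cong (σ i ⟨$⟩ʳ_) (sym (evaluate-resp-↭ ab (shift i p q) t))) (proj₁ r t))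
        (ℕ.≤-reflexive (cong suc (sym (↭-length (shift i p q))))))

module _ {m : ℕ} {i : Fin m} where

  open DecMembership (Fin._≟_ {m}) using (_∈?_)

  private
    variable
      u w : Permutation′ (suc m)
      b c c′ : List (Fin m)

  commuting⇒Unique-∷ : AllPairs _◁_ b → i ∉ b → Unique (i ∷ b)
  commuting⇒Unique-∷ ab i∉b = All.tabulate (λ { j∈b refl → i∉b j∈b }) ∷ AllPairs.map ◁⇒≢ ab

  ≤wk⇒letters-↭ : u ≤wk w → IsReducedDecomposition u (i ∷ c) → IsReducedDecomposition w (i ∷ c′) →
                  Unique (i ∷ c′) → ∃[ d ] c ++ d ↭ c′
  ≤wk⇒letters-↭ {u} {w} {c} {c′} u≤w ru (c′≈w , _) uc′
    with d , rd ← ≤wk-extend {u = u} {w = w} {a = i ∷ c} u≤w ru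
    = d , drop-∷ (Unique∧reduced⇒↭ {w = w} {e = i ∷ c ++ d} uc′ rd c′≈w)

  ≤wk⇒letters-⊆ : u ≤wk w → IsReducedDecomposition u (i ∷ c) → IsReducedDecomposition w (i ∷ c′) →
                  Unique (i ∷ c′) → c ⊆ c′
  ≤wk⇒letters-⊆ {u} {w} {c} {c′} u≤w ru rw uc′ x∈c
    with d , cd↭c′ ← ≤wk⇒letters-↭ {u} {w} {c} {c′} u≤w ru rw uc′ = ∈-resp-↭ cd↭c′ (∈-++⁺ˡ x∈c)

  letters-⊆⇒≤wk : c ⊆ c′ → Unique c → AllPairs _◁_ c′ →
                  IsReducedDecomposition u (i ∷ c) → IsReducedDecomposition w (i ∷ c′) → u ≤wk w
  letters-⊆⇒≤wk {c} {c′} {u} {w} c⊆c′ uc ac′ ru rw@(c′≈w , _)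
    with d , c′↭cd ← Unique∧⊆⇒↭ uc c⊆c′
    = i ∷ c , d , ru , reduced-≤ {w = w} {a = i ∷ c′} {b = i ∷ c ++ d} rw
        (λ t → ≡.trans (cong (σ i ⟨$⟩ʳ_) (sym (evaluate-resp-↭ ac′ c′↭cd t))) (c′≈w t))
        (ℕ.≤-reflexive (cong suc (sym (↭-length c′↭cd))))

  commuting⇒σ≤wk : AllPairs _◁_ b → i ∉ b → σ i ≤wk evaluate (i ∷ b)
  commuting⇒σ≤wk {b} ab i∉b = letters-⊆⇒≤wk {[]} {b} {σ i} {evaluate (i ∷ b)} (λ ()) [] ab
    (Unique⇒reduced {a = i ∷ []} ([] ∷ [])) (Unique⇒reduced (commuting⇒Unique-∷ ab i∉b))

  commuting⇒boolean : AllPairs _◁_ b → i ∉ b → IsBoolean (Interval (σ i) (evaluate (i ∷ b)))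
  commuting⇒boolean {b} ab i∉b = length b , φ , record
    { isOrderMonomorphism = record
      { isOrderHomomorphism = record
        { cong = λ {u} {u′} u≈u′ → Sub.⊆-antisym
            (mono {u} {u′} (I.reflexive {u} {u′} u≈u′))
            (mono {u′} {u} (I.reflexive {u′} {u} (I.Eq.sym {u} {u′} u≈u′)))
        ; mono = λ {u} {u′} → mono {u} {u′}
        }
      ; injective = λ {u} {u′} eq → I.antisym {u} {u′}
          (cancel {u} {u′} (λ {j} → subst (j Sub.∈_) eq)) (cancel {u′} {u} (λ {j} → subst (j Sub.∈_) (sym eq)))
      ; cancel = λ {u} {u′} → cancel {u} {u′}
      }
    ; surjective = λ S → preimage S , λ {z} z≈ → φ-preimage S z z≈
    }
    where
    top : Permutation′ (suc m)
    top = evaluate (i ∷ b)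
    I : Poset 0ℓ 0ℓ 0ℓ
    I = Interval (σ i) top
    module I = Poset I
    ub : Unique (i ∷ b)
    ub = commuting⇒Unique-∷ ab i∉b

    letters : I.Carrier → List (Fin m)
    letters (u , σ≤u , _) = proj₁ (σ≤wk⇒head {i = i} {w = u} σ≤u)

    reduced : ∀ u → IsReducedDecomposition (proj₁ u) (i ∷ letters u)
    reduced (u , σ≤u , _) = proj₂ (σ≤wk⇒head {i = i} {w = u} σ≤u)

    letters-⊆ : ∀ u → letters u ⊆ b
    letters-⊆ u = ≤wk⇒letters-⊆ {proj₁ u} {top} {letters u} {b} (proj₂ (proj₂ u)) (reduced u) (Unique⇒reduced ub) ub

    commuting : ∀ u → AllPairs _◁_ (letters u)
    commuting u
      with d , cd↭b ← ≤wk⇒letters-↭ {proj₁ u} {top} {letters u} {b} (proj₂ (proj₂ u)) (reduced u) (Unique⇒reduced ub) ub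
      = AllPairs-++⁻ˡ (letters u) (AllPairs-resp-↭ Apart-sym (↭-sym cd↭b) ab)

    unique : ∀ u → Unique (i ∷ letters u)
    unique u = commuting⇒Unique-∷ (commuting u) (i∉b ∘ letters-⊆ u)

    φ : I.Carrier → Sub.Subset (length b)
    φ u = Vec.tabulate λ j → does (lookup b j ∈? letters u)

    ∈φ⁺ : ∀ u {j} → lookup b j ∈ letters u → j Sub.∈ φ u
    ∈φ⁺ u {j} ∈u = Vec.lookup⇒[]= j (φ u)
      (≡.trans (Vec.lookup∘tabulate _ j) (dec-true (lookup b j ∈? letters u) ∈u))

    ∈φ⁻ : ∀ u {j} → j Sub.∈ φ u → lookup b j ∈ letters u
    ∈φ⁻ u {j} j∈ with lookup b j ∈? letters u
      | ≡.trans (sym (Vec.lookup∘tabulate (λ j → does (lookup b j ∈? letters u)) j)) (Vec.[]=⇒lookup j∈)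
    ... | yes ∈u | _ = ∈u
    ... | no _   | ()

    mono : ∀ {u u′} → u I.≤ u′ → φ u Sub.⊆ φ u′
    mono {u} {u′} u≤u′ {j} j∈ = ∈φ⁺ u′
      (≤wk⇒letters-⊆ {proj₁ u} {proj₁ u′} u≤u′ (reduced u) (reduced u′) (unique u′) (∈φ⁻ u j∈))

    cancel : ∀ {u u′} → φ u Sub.⊆ φ u′ → u I.≤ u′
    cancel {u} {u′} φ⊆ = letters-⊆⇒≤wk {letters u} {letters u′} {proj₁ u} {proj₁ u′}
      (λ x∈ → let x≡ = lookup-index (letters-⊆ u x∈) in
        subst (_∈ letters u′) (sym x≡) (∈φ⁻ u′ (φ⊆ (∈φ⁺ u (subst (_∈ letters u) x≡ x∈)))))
      (AllPairs.tail (unique u)) (commuting u′) (reduced u) (reduced u′)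

    module _ (S : Sub.Subset (length b)) where

      chosen : List (Fin m)
      chosen = map (lookup b) (filter (Sub._∈? S) (allFin (length b)))

      ∈chosen⁺ : ∀ {j} → j Sub.∈ S → lookup b j ∈ chosen
      ∈chosen⁺ {j} j∈S = ∈-map⁺ (lookup b) (∈-filter⁺ (Sub._∈? S) (∈-allFin j) j∈S)

      ∈chosen⁻ : ∀ {j} → lookup b j ∈ chosen → j Sub.∈ S
      ∈chosen⁻ j∈ with j′ , j′∈ , eq ← ∈-map⁻ (lookup b) j∈ =
        subst (Sub._∈ S) (sym (Unique⇒lookup-injective (AllPairs.tail ub) eq))
          (proj₂ (∈-filter⁻ (Sub._∈? S) {xs = allFin (length b)} j′∈))

      chosen-⊆ : chosen ⊆ b
      chosen-⊆ x∈ with j , _ , refl ← ∈-map⁻ (lookup b) x∈ = ∈-lookup j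

      chosen-commuting : AllPairs _◁_ chosen
      chosen-commuting = AllPairs-fromUnique
        (map⁺ (Unique⇒lookup-injective (AllPairs.tail ub)) (filter⁺ (Sub._∈? S) (allFin⁺ (length b))))
        λ x∈ y∈ x≢y → AllPairs⇒related Apart-sym ab (chosen-⊆ x∈) (chosen-⊆ y∈) x≢y

      chosen-unique : Unique (i ∷ chosen)
      chosen-unique = commuting⇒Unique-∷ chosen-commuting (i∉b ∘ chosen-⊆)

      preimage : I.Carrier
      preimage = evaluate (i ∷ chosen) , commuting⇒σ≤wk chosen-commuting (i∉b ∘ chosen-⊆) ,
        letters-⊆⇒≤wk {chosen} {b} {evaluate (i ∷ chosen)} {top} chosen-⊆ (AllPairs.tail chosen-unique) ab
          (Unique⇒reduced chosen-unique) (Unique⇒reduced ub)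

      φ-preimage : ∀ z → z I.≈ preimage → φ z ≡ S
      φ-preimage z z≈ = Sub.⊆-antisym
        (λ j∈ → ∈chosen⁻ (∈-resp-↭ z↭ (∈φ⁻ z j∈)))
        (λ j∈ → ∈φ⁺ z (∈-resp-↭ (↭-sym z↭) (∈chosen⁺ j∈)))
        where
        z↭ : letters z ↭ chosen
        z↭ = drop-∷ (Unique∧reduced⇒↭ {w = proj₁ z} {e = i ∷ letters z} chosen-unique (reduced z) (λ t → sym (z≈ t)))

-- Counting independent sets in paths

-- The path has q ∸ 1 vertices.
IndependentSet : ℕ → Set
IndependentSet zero          = Fin 1
IndependentSet (suc zero)    = Fin 1
IndependentSet (suc (suc q)) = IndependentSet (suc q) ⊎ IndependentSet q

IndependentSet-count : ∀ q → Fin (fib (suc q)) ↔ IndependentSet q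
IndependentSet-count zero          = ↔-id _
IndependentSet-count (suc zero)    = ↔-id _
IndependentSet-count (suc (suc q)) =
  (IndependentSet-count (suc q) ⊎-↔ IndependentSet-count q) ↔-∘ Fin.+↔⊎ {fib (suc (suc q))}

Independent : (ℕ → Bool) → Set
Independent h = ∀ j → h j ≡ true → h (suc j) ≡ true → ⊥

decode : ∀ q → IndependentSet q → ℕ → Bool
decode zero          _        _             = false
decode (suc zero)    _        _             = false
decode (suc (suc q)) (inj₁ s) zero          = false
decode (suc (suc q)) (inj₁ s) (suc j)       = decode (suc q) s j
decode (suc (suc q)) (inj₂ s) zero          = true
decode (suc (suc q)) (inj₂ s) (suc zero)    = false
decode (suc (suc q)) (inj₂ s) (suc (suc j)) = decode q s j

encode : ∀ q → (ℕ → Bool) → IndependentSet q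
encode zero          h = Fin.zero
encode (suc zero)    h = Fin.zero
encode (suc (suc q)) h =
  if h 0 then inj₂ (encode q (h ∘ suc ∘ suc)) else inj₁ (encode (suc q) (h ∘ suc))

decode-independent : ∀ q s → Independent (decode q s)
decode-independent (suc (suc q)) (inj₁ s) (suc j)       = decode-independent (suc q) s j
decode-independent (suc (suc q)) (inj₂ s) zero          _ ()
decode-independent (suc (suc q)) (inj₂ s) (suc (suc j)) = decode-independent q s j

encode-cong : ∀ q {f g} → (∀ j → suc j < q → f j ≡ g j) → encode q f ≡ encode q g
encode-cong zero          f≗g = refl
encode-cong (suc zero)    f≗g = refl
encode-cong (suc (suc q)) {f} {g} f≗g = ≡.trans
  (cong (if_then inj₂ (encode q (f ∘ suc ∘ suc)) else inj₁ (encode (suc q) (f ∘ suc))) (f≗g 0 (s≤s z<s)))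
  (cong₂ (if g 0 then_else_)
    (cong inj₂ (encode-cong q λ j j<q → f≗g (suc (suc j)) (s≤s (s≤s j<q))))
    (cong inj₁ (encode-cong (suc q) λ j j<q → f≗g (suc j) (s≤s j<q))))

encode-decode : ∀ q s → encode q (decode q s) ≡ s
encode-decode zero          Fin.zero = refl
encode-decode (suc zero)    Fin.zero = refl
encode-decode (suc (suc q)) (inj₁ s) = cong inj₁ (encode-decode (suc q) s)
encode-decode (suc (suc q)) (inj₂ s) = cong inj₂ (encode-decode q s)

decode-encode : ∀ q {h} → Independent h → ∀ j → suc j < q → decode q (encode q h) j ≡ h j
decode-encode (suc zero) ind j (s≤s ())
decode-encode (suc (suc q)) {h} ind j j<q with h 0 in h0
decode-encode (suc (suc q)) {h} ind zero          _              | true  = sym h0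
decode-encode (suc (suc q)) {h} ind (suc zero)    _              | true  = sym (¬-not (ind 0 h0))
decode-encode (suc (suc q)) {h} ind (suc (suc j)) (s≤s (s≤s j<q)) | true =
  decode-encode q (λ j → ind (suc (suc j))) j j<q
decode-encode (suc (suc q)) {h} ind zero          _              | false = sym h0
decode-encode (suc (suc q)) {h} ind (suc j)       (s≤s j<q)      | false =
  decode-encode (suc q) (λ j → ind (suc j)) j j<q

glue : ℕ → (ℕ → Bool) → (ℕ → Bool) → ℕ → Bool
glue zero    f g zero    = false
glue zero    f g (suc j) = g j
glue (suc i) f g zero    = f 0
glue (suc i) f g (suc j) = glue i (f ∘ suc) g j

glue-< : ∀ {i f g j} → j < i → glue i f g j ≡ f j
glue-< {suc i} {j = zero}  _         = refl
glue-< {suc i} {j = suc j} (s≤s j<i) = glue-< {i} j<i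

glue-≡ : ∀ i {f g} → glue i f g i ≡ false
glue-≡ zero    = refl
glue-≡ (suc i) = glue-≡ i

glue-> : ∀ i {f g} j → glue i f g (suc i + j) ≡ g j
glue-> zero    j = refl
glue-> (suc i) j = glue-> i j

glue-independent : ∀ i {f g} → Independent f → Independent g → Independent (glue i f g)
glue-independent zero          indf indg (suc j) = indg j
glue-independent (suc zero)    indf indg zero _ ()
glue-independent (suc (suc i)) indf indg zero    = indf 0
glue-independent (suc i) {f}   indf indg (suc j) = glue-independent i {f ∘ suc} (λ j → indf (suc j)) indg j

glue-unique : ∀ {i m} {f g h : ℕ → Bool} → (∀ j → j < i → f j ≡ h j) → h i ≡ false →
              (∀ j → suc i + j < m → g j ≡ h (suc i + j)) → ∀ j → j < m → glue i f g j ≡ h j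
glue-unique {i} {m} {f} {g} {h} left mid right j j<m with ℕ.<-cmp j i
... | tri< j<i _ _    = ≡.trans (glue-< {i} {f} {g} j<i) (left j j<i)
... | tri≈ _ refl _   = ≡.trans (glue-≡ i {f} {g}) (sym mid)
... | tri> _ _ i<j    = subst (λ j → glue i f g j ≡ h j) split
    (≡.trans (glue-> i {f} {g} (j ∸ suc i)) (right (j ∸ suc i) (subst (_< m) (sym split) j<m)))
  where
  split : suc i + (j ∸ suc i) ≡ j
  split = ℕ.m+[n∸m]≡n i<j

module _ {m : ℕ} where

  open DecMembership ℕ._≟_ using () renaming (_∈?_ to _∈ℕ?_)

  χ : List (Fin m) → ℕ → Bool
  χ b j = does (j ∈ℕ? map toℕ b)

  χ⁺ : ∀ {b x} → x ∈ b → χ b (toℕ x) ≡ true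
  χ⁺ {b} {x} x∈b = dec-true (toℕ x ∈ℕ? map toℕ b) (∈-map⁺ toℕ x∈b)

  χ⁻ : ∀ {b j} → χ b j ≡ true → ∃[ x ] x ∈ b × j ≡ toℕ x
  χ⁻ {b} {j} eq with yes j∈ ← j ∈ℕ? map toℕ b = ∈-map⁻ toℕ j∈

  χ-toℕ⁻ : ∀ {b x} → χ b (toℕ x) ≡ true → x ∈ b
  χ-toℕ⁻ {b} eq with y , y∈b , x≡y ← χ⁻ {b} eq = subst (_∈ b) (sym (Fin.toℕ-injective x≡y)) y∈b

  χ-resp-↭ : ∀ {b c} → b ↭ c → ∀ j → χ b j ≡ χ c j
  χ-resp-↭ {b} {c} b↭c j = does-⇔
    (mk⇔ (∈-resp-↭ (↭.map⁺ toℕ b↭c)) (∈-resp-↭ (↭.map⁺ toℕ (↭-sym b↭c))))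
    (j ∈ℕ? map toℕ b) (j ∈ℕ? map toℕ c)

  χ-independent : ∀ {b} → AllPairs _◁_ b → Independent (χ b)
  χ-independent {b} ab j hj hsj with χ⁻ {b} hj | χ⁻ {b} hsj
  ... | x , x∈b , refl | y , y∈b , sx≡y
    with AllPairs⇒related Apart-sym ab x∈b y∈b (λ { refl → ℕ.1+n≢n sx≡y })
  ... | inj₁ sx<y = ℕ.<⇒≢ sx<y sx≡y
  ... | inj₂ sy<x = ℕ.1+n≰n (ℕ.≤-trans (ℕ.≤-reflexive sx≡y) (ℕ.≤-trans (ℕ.n≤1+n _) (ℕ.<⇒≤ sy<x)))

  word : (ℕ → Bool) → List (Fin m)
  word h = filter (λ x → h (toℕ x) Bool.≟ true) (allFin m)

  ∈-word⁺ : ∀ {h x} → h (toℕ x) ≡ true → x ∈ word h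
  ∈-word⁺ {h} {x} hx = ∈-filter⁺ (λ x → h (toℕ x) Bool.≟ true) (∈-allFin x) hx

  ∈-word⁻ : ∀ {h x} → x ∈ word h → h (toℕ x) ≡ true
  ∈-word⁻ {h} x∈ = proj₂ (∈-filter⁻ (λ x → h (toℕ x) Bool.≟ true) {xs = allFin m} x∈)

  word-unique : ∀ h → Unique (word h)
  word-unique h = filter⁺ (λ x → h (toℕ x) Bool.≟ true) (allFin⁺ m)

  word-commuting : ∀ {h} → Independent h → AllPairs _◁_ (word h)
  word-commuting {h} ind = AllPairs-fromUnique (word-unique h) λ x∈ y∈ x≢y →
    apart (∈-word⁻ {h} x∈) (∈-word⁻ {h} y∈) (x≢y ∘ Fin.toℕ-injective)
    where
    apart : ∀ {k l} → h k ≡ true → h l ≡ true → k ≢ l → Apart k l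
    apart {k} {l} hk hl k≢l with ℕ.<-cmp k l
    ... | tri≈ _ k≡l _ = contradiction k≡l k≢l
    ... | tri< k<l _ _ = inj₁ (ℕ.≤∧≢⇒< k<l λ { refl → ind k hk hl })
    ... | tri> _ _ l<k = inj₂ (ℕ.≤∧≢⇒< l<k λ { refl → ind l hl hk })

  χ-word : ∀ h j → j < m → χ (word h) j ≡ h j
  χ-word h j j<m = subst (λ j → χ (word h) j ≡ h j) (Fin.toℕ-fromℕ< j<m)
    (⇔→≡ {z = true} (mk⇔ (∈-word⁻ {h} ∘ χ-toℕ⁻) (χ⁺ ∘ ∈-word⁺ {h})))

  word-χ : ∀ {h b} → Unique b → (∀ j → j < m → h j ≡ χ b j) → b ↭ word h
  word-χ {h} {b} ub h≗χ = Unique∧⊆∧≤⇒↭ (word-unique h) word⊆b (Unique∧⊆⇒≤ ub b⊆word)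
    where
    word⊆b : word h ⊆ b
    word⊆b {x} x∈ = χ-toℕ⁻ (≡.trans (sym (h≗χ (toℕ x) (Fin.toℕ<n x))) (∈-word⁻ {h} x∈))
    b⊆word : b ⊆ word h
    b⊆word {x} x∈ = ∈-word⁺ {h} (≡.trans (h≗χ (toℕ x) (Fin.toℕ<n x)) (χ⁺ x∈))

Sides : ∀ {m} → Fin m → Set
Sides {m} i = IndependentSet (suc (toℕ i)) × IndependentSet (m ∸ toℕ i)

Sides-count : ∀ {m} (i : Fin m) →
  Fin (fib (suc (toℕ i) + 1) * fib ((m ∸ toℕ i) + 1)) ↔ Sides i
Sides-count {m} i =
  (count (suc (toℕ i)) ×-↔ count (m ∸ toℕ i)) ↔-∘ Fin.*↔× {fib (suc (toℕ i) + 1)}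
  where
  count : ∀ q → Fin (fib (q + 1)) ↔ IndependentSet q
  count q = subst (λ n → Fin (fib n) ↔ IndependentSet q) (ℕ.+-comm 1 q) (IndependentSet-count q)

module _ {m : ℕ} (i : Fin m) where

  private
    module B = Setoid (BooleanIntervalsFrom (σ i))

  join : Sides i → ℕ → Bool
  join (l , r) = glue (toℕ i) (decode _ l) (decode _ r)

  split : (ℕ → Bool) → Sides i
  split h = encode _ h , encode _ (λ j → h (suc (toℕ i) + j))

  join-independent : ∀ s → Independent (join s)
  join-independent (l , r) =
    glue-independent (toℕ i) (decode-independent (suc (toℕ i)) l) (decode-independent (m ∸ toℕ i) r)

  right-bound⁺ : ∀ j → suc j < m ∸ toℕ i → suc (toℕ i) + j < m
  right-bound⁺ j lt = subst₂ _<_ (ℕ.+-suc (toℕ i) j) (ℕ.m+[n∸m]≡n (ℕ.<⇒≤ (Fin.toℕ<n i)))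
    (ℕ.+-monoʳ-< (toℕ i) lt)

  right-bound⁻ : ∀ j → suc (toℕ i) + j < m → suc j < m ∸ toℕ i
  right-bound⁻ j lt = ℕ.+-cancelˡ-< (toℕ i) (suc j) (m ∸ toℕ i)
    (subst₂ _<_ (sym (ℕ.+-suc (toℕ i) j)) (sym (ℕ.m+[n∸m]≡n (ℕ.<⇒≤ (Fin.toℕ<n i)))) lt)

  split-cong : ∀ {g h} → (∀ j → j < m → g j ≡ h j) → split g ≡ split h
  split-cong g≗h = cong₂ _,_
    (encode-cong (suc (toℕ i)) λ j j<i → g≗h j (ℕ.<-trans (ℕ.≤-pred j<i) (Fin.toℕ<n i)))
    (encode-cong (m ∸ toℕ i) λ j j< → g≗h (suc (toℕ i) + j) (right-bound⁺ j j<))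

  split-join : ∀ s → split (join s) ≡ s
  split-join (l , r) = cong₂ _,_
    (≡.trans (encode-cong (suc (toℕ i)) λ j j<i → glue-< (ℕ.≤-pred j<i)) (encode-decode (suc (toℕ i)) l))
    (≡.trans (encode-cong (m ∸ toℕ i) λ j _ → glue-> (toℕ i) j) (encode-decode (m ∸ toℕ i) r))

  join-split : ∀ {h} → Independent h → h (toℕ i) ≡ false → ∀ j → j < m → join (split h) j ≡ h j
  join-split {h} ind hi = glue-unique {toℕ i} {m} {h = h}
    (λ j j<i → decode-encode (suc (toℕ i)) ind j (s≤s j<i)) hi
    (λ j j< → decode-encode (m ∸ toℕ i) {λ j → h (suc (toℕ i) + j)} (λ j hj hsj → ind (suc (toℕ i) + j) hj
      (subst (λ n → h n ≡ true) (ℕ.+-suc (suc (toℕ i)) j) hsj)) j (right-bound⁻ j j<))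

  letters : B.Carrier → List (Fin m)
  letters (w , σ≤w , _) = proj₁ (σ≤wk⇒head {i = i} {w = w} σ≤w)

  letters-reduced : ∀ t → IsReducedDecomposition (proj₁ t) (i ∷ letters t)
  letters-reduced (w , σ≤w , _) = proj₂ (σ≤wk⇒head {i = i} {w = w} σ≤w)

  letters-commuting : ∀ t → AllPairs _◁_ (letters t) × i ∉ letters t
  letters-commuting t@(w , σ≤w , bool) = boolean⇒commuting {i = i} {w = w} bool (letters-reduced t)

  letters-unique : ∀ t → Unique (i ∷ letters t)
  letters-unique t = commuting⇒Unique-∷ (proj₁ (letters-commuting t)) (proj₂ (letters-commuting t))

  letters-↭ : ∀ t {b} → Unique (i ∷ b) → evaluate (i ∷ b) ≈ proj₁ t → letters t ↭ b
  letters-↭ t ub b≈w = drop-∷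
    (Unique∧reduced⇒↭ {w = proj₁ t} {e = i ∷ letters t} ub (letters-reduced t) b≈w)

  letters-cong : ∀ t t′ → t B.≈ t′ → letters t ↭ letters t′
  letters-cong t t′ t≈t′ = letters-↭ t (letters-unique t′)
    (λ x → ≡.trans (proj₁ (letters-reduced t′) x) (sym (t≈t′ x)))

  i∉word-join : ∀ s → i ∉ word (join s)
  i∉word-join s i∈ with () ← ≡.trans (sym (glue-≡ (toℕ i))) (∈-word⁻ {h = join s} i∈)

  toInterval : Sides i → B.Carrier
  toInterval s = evaluate (i ∷ word (join s)) ,
    commuting⇒σ≤wk (word-commuting (join-independent s)) (i∉word-join s) ,
    commuting⇒boolean (word-commuting (join-independent s)) (i∉word-join s)

  fromInterval : B.Carrier → Sides i
  fromInterval t = split (χ (letters t))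

  toInterval-fromInterval : ∀ t → toInterval (fromInterval t) B.≈ t
  toInterval-fromInterval t x = ≡.trans
    (cong (σ i ⟨$⟩ʳ_) (sym (evaluate-resp-↭ (proj₁ (letters-commuting t))
      (word-χ (AllPairs.tail (letters-unique t)) (join-split (χ-independent (proj₁ (letters-commuting t)))
        (¬-not (proj₂ (letters-commuting t) ∘ χ-toℕ⁻)))) x)))
    (proj₁ (letters-reduced t) x)

  fromInterval-toInterval : ∀ s t → t B.≈ toInterval s → fromInterval t ≡ s
  fromInterval-toInterval s t t≈ = ≡.trans (split-cong λ j j<m → ≡.trans
      (χ-resp-↭ (letters-↭ t (commuting⇒Unique-∷ (word-commuting (join-independent s)) (i∉word-join s))
        (λ x → sym (t≈ x))) j)
      (χ-word (join s) j j<m))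
    (split-join s)

  Sides↔BooleanIntervals : Inverse (setoid (Sides i)) (BooleanIntervalsFrom (σ i))
  Sides↔BooleanIntervals = record
    { to        = toInterval
    ; from      = fromInterval
    ; to-cong   = λ { refl _ → refl }
    ; from-cong = λ {t} {t′} t≈t′ → split-cong λ j _ → χ-resp-↭ (letters-cong t t′ t≈t′) j
    ; inverse   = (λ { {t} refl → toInterval-fromInterval t })
                , (λ {s} {t} → fromInterval-toInterval s t)
    }

proposition5p9 : (m : ℕ) (i : Fin m) →
    let n = suc m
        k = suc (toℕ i)
    in HasCardinality (BooleanIntervalsFrom (σ i)) (fib (k + 1) * fib ((n ∸ k) + 1))
proposition5p9 m i = Composition.inverse (Sides-count i) (Sides↔BooleanIntervals i)
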